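{- Let $G$ be a connected graph of order $n\ge 2$. Then $sn(G)=1$ if and only if $G$ is a bipartite graph.
   Context: Graphs are finite, undirected, simple and connected. Let $G=(V,E)$ be a graph with chromatic number $\chi(G)=k\ge 2$. For $S\subset V$, a partial coloring on $G[S]$ is a proper coloring $\mathscr C_0$ of the induced subgraph $G[S]$ with colors from $\{1,\dots,k\}$ (not all colors need be used). It is a Sudoku coloring of $G$ if there is exactly one proper $k$-coloring $V\to\{1,\dots,k\}$ of $G$ whose restriction to $S$ is $\mathscr C_0$. The Sudoku number $sn(G)$ is the smallest $|S|$ such that $G[S]$ admits a Sudoku coloring of $G$. -}

module Defs where

open import Data.Fin.Base using (Fin; finToFun; funToFin)
open import Data.Fin.Properties using (_≟_; any?; all?; finToFun-funToFin)
open import Data.Fin.Subset using (Subset; _∈_; _∉_; ∣_∣; ⊤)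
open import Data.Fin.Subset.Properties using (_∈?_; ∈⊤; anySubset?)
open import Data.Nat.Base using (ℕ; zero; suc; _≤_; z≤n; s≤s)
import Data.Nat.Properties as ℕ
open import Data.Product.Base using (Σ-syntax; ∃; _×_; _,_; proj₁; proj₂)
open import Data.Sum.Base using (_⊎_)
open import Function.Base using (_∘_; id)
open import Level using (0ℓ)
open import Relation.Binary.Construct.Closure.ReflexiveTransitive using (Star)
open import Relation.Binary.Core using (Rel)
import Relation.Binary.Definitions as B
open import Relation.Binary.PropositionalEquality
  using (_≡_; _≢_; _≗_; refl; sym; trans)
open import Relation.Nullary using (Dec; yes; no; ¬_; contradiction)
open import Relation.Nullary.Decidable using (map′; _×-dec_; _→-dec_; ¬?)
open import Relation.Unary using (Pred; Decidable)

record Graph (V : Set) : Set₁ where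
  field
    Adj     : Rel V 0ℓ
    adj?    : B.Decidable Adj
    adj-sym : B.Symmetric Adj
    noLoops : ∀ {v} → ¬ Adj v v

-- The vertex set is Fin n, so n is the order of the graph.
FinGraph : ℕ → Set₁
FinGraph n = Graph (Fin n)

Connected : ∀ {V} → Graph V → Set
Connected {V} G = ∀ (u v : V) → Star (Graph.Adj G) u v

-- The parts are A and its complement; one of them may be empty.
Bipartite : ∀ {n} → FinGraph n → Set
Bipartite {n} G = Σ[ A ∈ Subset n ]
  (∀ u v → Graph.Adj G u v → (u ∈ A × v ∉ A) ⊎ (u ∉ A × v ∈ A))

Members : ∀ {n} → Subset n → Set
Members {n} S = Σ[ v ∈ Fin n ] v ∈ S

induced : ∀ {n} → FinGraph n → (S : Subset n) → Graph (Members S)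
induced G S = record
  { Adj     = λ x y → Graph.Adj G (proj₁ x) (proj₁ y)
  ; adj?    = λ x y → Graph.adj? G (proj₁ x) (proj₁ y)
  ; adj-sym = Graph.adj-sym G
  ; noLoops = Graph.noLoops G
  }

Proper : ∀ {V k} → Graph V → (V → Fin k) → Set
Proper {V} G c = ∀ (u v : V) → Graph.Adj G u v → c u ≢ c v

Colorable : ∀ {V} → Graph V → ℕ → Set
Colorable {V} G k = Σ[ c ∈ (V → Fin k) ] Proper G c

IsLeast : Pred ℕ 0ℓ → ℕ → Set
IsLeast P m = P m × (∀ j → P j → m ≤ j)

least : ∀ {P : Pred ℕ 0ℓ} → Decidable P → ∀ m → P m → ∃ (IsLeast P)
least P? zero    p0 = zero , p0 , λ _ _ → z≤n
least P? (suc m) pm with P? zero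
... | yes p0 = zero , p0 , λ _ _ → z≤n
... | no ¬p0 with least (P? ∘ suc) m pm
...   | l , pl , min = suc l , pl , λ
        { zero    p0 → contradiction p0 ¬p0
        ; (suc j) pj → s≤s (min j pj) }

-- Quantifiers over the finite set of functions Fin n → Fin k are decidable for
-- predicates that respect pointwise equality.
module _ {n k : ℕ} {P : (Fin n → Fin k) → Set}
         (resp : ∀ {f g} → f ≗ g → P f → P g)
         (P? : ∀ f → Dec (P f)) where

  anyFun? : Dec (∃ P)
  anyFun? = map′ (λ (i , p) → finToFun i , p)
                 (λ (f , p) → funToFin f , resp (sym ∘ finToFun-funToFin f) p)
                 (any? (λ i → P? (finToFun {k} {n} i)))

  allFun? : Dec (∀ f → P f)
  allFun? = map′ (λ h f → resp (finToFun-funToFin f) (h (funToFin f)))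
                 (λ h i → h (finToFun i))
                 (all? (λ i → P? (finToFun {k} {n} i)))

module _ {n : ℕ} (G : FinGraph n) where

  proper-resp : ∀ {k} {c d : Fin n → Fin k} → c ≗ d → Proper G c → Proper G d
  proper-resp c≗d p u v a du≡dv =
    p u v a (trans (c≗d u) (trans du≡dv (sym (c≗d v))))

  proper? : ∀ {k} (c : Fin n → Fin k) → Dec (Proper G c)
  proper? c = all? λ u → all? λ v → Graph.adj? G u v →-dec ¬? (c u ≟ c v)

  chromatic : ∃ (IsLeast (Colorable G))
  chromatic = least (λ k → anyFun? proper-resp (proper? {k})) n (id , proper-id)
    where
    proper-id : Proper G id
    proper-id u .u a refl = Graph.noLoops G a

  χ : ℕ
  χ = proj₁ chromatic

  Extends : ∀ {k S} → (Fin n → Fin k) → (Members S → Fin k) → Set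
  Extends {S = S} c c₀ = ∀ (x : Members S) → c (proj₁ x) ≡ c₀ x

  -- Colorings are compared pointwise, as functions are not extensional here.
  UniquelyExtends : ∀ {S} → (Members S → Fin χ) → Set
  UniquelyExtends c₀ = Σ[ c ∈ (Fin n → Fin χ) ]
    ((Proper G c × Extends c c₀) ×
     (∀ d → Proper G d × Extends d c₀ → d ≗ c))

  AdmitsSudoku : Subset n → Set
  AdmitsSudoku S = Σ[ c₀ ∈ (Members S → Fin χ) ]
    (Proper (induced G S) c₀ × UniquelyExtends c₀)

  SudokuSize : ℕ → Set
  SudokuSize s = Σ[ S ∈ Subset n ] (∣ S ∣ ≡ s × AdmitsSudoku S)

  -- A Sudoku coloring is the restriction of its own extension, so it suffices
  -- to search through colorings of the whole graph.
  module _ (S : Subset n) where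

    Agree : ∀ {k} → (Fin n → Fin k) → (Fin n → Fin k) → Set
    Agree d c = ∀ v → v ∈ S → d v ≡ c v

    Determined : ∀ {k} → (Fin n → Fin k) → Set
    Determined c = Proper G c × (∀ d → Proper G d × Agree d c → d ≗ c)

    determined-resp : ∀ {k} {c d : Fin n → Fin k} → c ≗ d →
                      Determined c → Determined d
    determined-resp c≗d (p , u) = proper-resp c≗d p , λ e (pe , ae) v →
      trans (u e (pe , λ w w∈S → trans (ae w w∈S) (sym (c≗d w))) v) (c≗d v)

    determined? : ∀ {k} (c : Fin n → Fin k) → Dec (Determined c)
    determined? c = proper? c ×-dec allFun?
      (λ f≗g h (pg , ag) v → trans (sym (f≗g v))
         (h (proper-resp (sym ∘ f≗g) pg , λ w w∈S → trans (f≗g w) (ag w w∈S)) v))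
      (λ d → (proper? d ×-dec all? λ v → (v ∈? S) →-dec (d v ≟ c v))
             →-dec all? λ v → d v ≟ c v)

    admitsSudoku? : Dec (AdmitsSudoku S)
    admitsSudoku? = map′ to from (anyFun? determined-resp determined?)
      where
      to : ∃ Determined → AdmitsSudoku S
      to (c , p , u) = c ∘ proj₁ , (λ x y → p (proj₁ x) (proj₁ y)) ,
        c , (p , λ _ → refl) , λ d (pd , ed) → u d (pd , λ v v∈S → ed (v , v∈S))

      from : AdmitsSudoku S → ∃ Determined
      from (_ , _ , c , (p , e) , u) = c , p , λ d (pd , ad) →
        u d (pd , λ x → trans (ad (proj₁ x) (proj₂ x)) (e x))

  sudoku : ∃ (IsLeast SudokuSize)
  sudoku = least (λ s → anySubset? λ S → (∣ S ∣ ℕ.≟ s) ×-dec admitsSudoku? S)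
                 ∣ ⊤ {n} ∣ (⊤ , refl , whole)
    where
    whole : AdmitsSudoku ⊤
    whole with c , p ← proj₁ (proj₂ chromatic) =
      c ∘ proj₁ , (λ x y → p (proj₁ x) (proj₁ y)) ,
      c , (p , λ _ → refl) , λ d (_ , e) v → e (v , ∈⊤)

  sn : ℕ
  sn = proj₁ sudoku

{-# OPTIONS --safe #-}

-- Swapping the colors c u and c w of the ends of an edge uw changes a proper
-- coloring c but keeps it proper, so a coloring determined by its values on S
-- must use c u or c w on S.  For S = {v} every edge thus has an end in the
-- color class of v, which makes this class one side of a bipartition; S = ∅ is
-- impossible as soon as there is an edge.  Conversely, in a connected graph a
-- coloring with at most two colors propagates along paths from any one vertex.
module Submission where

open import Defs
open import Data.Bool.Base using (if_then_else_)
open import Data.Fin.Base using (Fin; zero; suc)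
open import Data.Fin.Permutation.Components using (transpose; transpose-inverse)
open import Data.Fin.Properties using (_≟_)
open import Data.Fin.Subset using (Subset; _∈_; _∉_; _⊆_; ⁅_⁆; ∣_∣; Empty; _-_)
open import Data.Fin.Subset.Properties
  using ( _∈?_; nonempty?; Empty-unique; ∣⊥∣≡0; x∈⁅x⁆; x∈⁅y⁆⇒x≡y; ∣⁅x⁆∣≡1
        ; x∈p⇒∣p-x∣<∣p∣; p⊂q⇒∣p∣<∣q∣)
open import Data.Nat.Base using (ℕ; _≤_; _<_; z≤n; s≤s)
open import Data.Nat.Properties using (n≮n; n≮0; n≢0⇒n>0; ≤-antisym)
open import Data.Product.Base using (∃; ∃-syntax; _×_; _,_; proj₁; proj₂)
open import Data.Sum.Base using (_⊎_; inj₁; inj₂)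
open import Data.Vec.Base using (tabulate)
open import Data.Vec.Properties using (lookup∘tabulate; []=⇒lookup; lookup⇒[]=)
open import Function.Base using (_∘_)
open import Function.Bundles using (_⇔_; mk⇔)
open import Function.Definitions using (Injective)
open import Relation.Binary.Construct.Closure.ReflexiveTransitive using (Star; ε; _◅_)
open import Relation.Binary.PropositionalEquality
  using (_≡_; _≢_; refl; sym; trans; cong; subst; subst₂)
open import Relation.Nullary using (yes; no; does; ¬_; contradiction)
open import Relation.Nullary.Decidable using (dec-true; dec-false; decidable-stable)
open import Relation.Unary using (Pred; Decidable)
open import Level using (0ℓ)

transpose-injective : ∀ {n} (i j : Fin n) → Injective _≡_ _≡_ (transpose i j)
transpose-injective i j eq =
  trans (sym (transpose-inverse j i))
        (trans (cong (transpose j i) eq) (transpose-inverse j i))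

transpose-matchˡ : ∀ {n} (i j : Fin n) → transpose i j i ≡ j
transpose-matchˡ i j rewrite dec-true (i ≟ i) refl = refl

transpose-mismatch : ∀ {n} {i j k : Fin n} → k ≢ i → k ≢ j → transpose i j k ≡ k
transpose-mismatch {i = i} {j} {k} k≢i k≢j
  rewrite dec-false (k ≟ i) k≢i | dec-false (k ≟ j) k≢j = refl

≢-≢⇒≡ : ∀ {k} → k ≤ 2 → {x y z : Fin k} → x ≢ y → x ≢ z → y ≡ z
≢-≢⇒≡ _ {zero}  {zero}  x≢y _ = contradiction refl x≢y
≢-≢⇒≡ _ {zero}  {suc _} {zero}  _ x≢z = contradiction refl x≢z
≢-≢⇒≡ _ {suc _} {zero}  {zero}  _ _ = refl
-- The bound is matched only from here on: a `suc` among the elements forces `k` to be exactly 2.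
≢-≢⇒≡ (s≤s (s≤s z≤n)) {zero}     {suc zero} {suc zero} _ _ = refl
≢-≢⇒≡ (s≤s (s≤s z≤n)) {suc zero} {suc zero} x≢y _ = contradiction refl x≢y
≢-≢⇒≡ (s≤s (s≤s z≤n)) {suc zero} {zero}     {suc zero} _ x≢z = contradiction refl x≢z

module _ {n} {P : Pred (Fin n) 0ℓ} (P? : Decidable P) where

  comprehension : Subset n
  comprehension = tabulate (does ∘ P?)

  ∈-comprehension⁺ : ∀ {x} → P x → x ∈ comprehension
  ∈-comprehension⁺ {x} px =
    lookup⇒[]= x _ (trans (lookup∘tabulate _ x) (dec-true (P? x) px))

  ∈-comprehension⁻ : ∀ {x} → x ∈ comprehension → P x
  -- Abstracting `P? x` also rewrites the equation beside it, which becomes `false ≡ true` in the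
  -- `no` case.
  ∈-comprehension⁻ {x} x∈ with P? x | trans (sym (lookup∘tabulate (does ∘ P?) x)) ([]=⇒lookup x∈)
  ... | yes px | _ = px
  ... | no _   | ()

∣p∣≡0⇒Empty : ∀ {n} {p : Subset n} → ∣ p ∣ ≡ 0 → Empty p
∣p∣≡0⇒Empty {p = p} eq (x , x∈p) = n≮0 (subst (∣ p - x ∣ <_) eq (x∈p⇒∣p-x∣<∣p∣ x∈p))

-- A second element would make `⁅ x ⁆` a proper subset of `p`, giving 1 < 1.
∣p∣≡1⇒singleton : ∀ {n} {p : Subset n} → ∣ p ∣ ≡ 1 →
                  ∃[ x ] (∀ {y} → y ∈ p → y ≡ x)
∣p∣≡1⇒singleton {n} {p} eq with nonempty? p
... | no ¬ne with () ← trans (sym eq) (trans (cong ∣_∣ (Empty-unique ¬ne)) (∣⊥∣≡0 n))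
... | yes (x , x∈p) = x , λ {y} y∈p → decidable-stable (y ≟ x) λ y≢x →
  n≮n 1 (subst₂ _<_ (∣⁅x⁆∣≡1 x) eq
    (p⊂q⇒∣p∣<∣q∣ (⁅x⁆⊆p x∈p , y , y∈p , y≢x ∘ x∈⁅y⁆⇒x≡y x)))
  where
  ⁅x⁆⊆p : ∀ {x} → x ∈ p → ⁅ x ⁆ ⊆ p
  ⁅x⁆⊆p {x} x∈p y∈ = subst (_∈ p) (sym (x∈⁅y⁆⇒x≡y x y∈)) x∈p

module _ {n} (G : FinGraph n) where
  open Graph G

  edge : Connected G → 2 ≤ n → ∃[ u ] ∃[ w ] Adj u w
  edge conn (s≤s (s≤s _)) with conn zero (suc zero)
  -- A path between distinct vertices is not empty, so it has a first edge.
  ... | a ◅ _ = _ , _ , a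

  determined-meets-edge : ∀ {S k} {c : Fin n → Fin k} → Determined G S c →
    ∀ {u w} → Adj u w → ¬ (∀ v → v ∈ S → c v ≢ c u × c v ≢ c w)
  determined-meets-edge {S} {k} {c} (p , unique) {u} {w} a avoids =
    -- Uniqueness gives `c u ≡ d u`, while the swap gives `d u ≡ c w`; the edge forbids `c u ≡ c w`.
    p u w a (trans (sym (unique d (d-proper , d-agrees) u)) (transpose-matchˡ (c u) (c w)))
    where
    d : Fin n → Fin k
    d = transpose (c u) (c w) ∘ c

    d-proper : Proper G d
    d-proper x y b = p x y b ∘ transpose-injective (c u) (c w)

    d-agrees : Agree G S d c
    d-agrees v v∈S = let ≢u , ≢w = avoids v v∈S in transpose-mismatch ≢u ≢w

  sudoku⇒determined : ∀ {S} → AdmitsSudoku G S → ∃ (Determined G S {χ G})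
  sudoku⇒determined (_ , _ , c , (p , e) , unique) = c , p , λ d (pd , ad) →
    unique d (pd , λ (v , v∈S) → trans (ad v v∈S) (e (v , v∈S)))

  determined⇒sudoku : ∀ {S c} → Determined G S {χ G} c → AdmitsSudoku G S
  determined⇒sudoku {c = c} (p , unique) =
    c ∘ proj₁ , (λ x y → p (proj₁ x) (proj₁ y)) ,
    c , (p , λ _ → refl) , λ d (pd , ed) → unique d (pd , λ v v∈S → ed (v , v∈S))

  -- On the empty set every edge is vacuously avoided. This yields the lower bound on `sn`.
  ¬sudokuSize-0 : ∀ {u w} → Adj u w → ¬ SudokuSize G 0
  ¬sudokuSize-0 a (S , ∣S∣≡0 , s) =
    determined-meets-edge (proj₂ (sudoku⇒determined s)) a
      λ v v∈S → contradiction (v , v∈S) (∣p∣≡0⇒Empty ∣S∣≡0)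

  determined⇒bipartite : ∀ {S k} {c : Fin n → Fin k} →
                         ∣ S ∣ ≡ 1 → Determined G S c → Bipartite G
  determined⇒bipartite {c = c} ∣S∣≡1 det with v , only-v ← ∣p∣≡1⇒singleton ∣S∣≡1
    = comprehension class? , sides
    where
    class? : Decidable (λ u → c v ≡ c u)
    class? u = c v ≟ c u

    sides : ∀ u w → Adj u w →
      (u ∈ comprehension class? × w ∉ comprehension class?) ⊎
      (u ∉ comprehension class? × w ∈ comprehension class?)
    sides u w a with class? u | class? w
    ... | yes vu | _ = inj₁ (∈-comprehension⁺ class? vu ,
      λ w∈ → proj₁ det u w a (trans (sym vu) (∈-comprehension⁻ class? w∈)))
    ... | no ¬vu | yes vw = inj₂ (¬vu ∘ ∈-comprehension⁻ class? , ∈-comprehension⁺ class? vw)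
    -- The only color used on `S` is `c v`, so this edge would avoid all colors on `S`.
    ... | no ¬vu | no ¬vw = contradiction
      (λ x x∈S → subst (λ y → c y ≢ c u × c y ≢ c w) (sym (only-v x∈S)) (¬vu , ¬vw))
      (determined-meets-edge det a)

  sudokuSize-1⇒bipartite : SudokuSize G 1 → Bipartite G
  sudokuSize-1⇒bipartite (_ , ∣S∣≡1 , s) =
    determined⇒bipartite ∣S∣≡1 (proj₂ (sudoku⇒determined s))

  bipartite⇒2-colorable : Bipartite G → Colorable G 2
  bipartite⇒2-colorable (A , sides) = color , proper
    where
    color : Fin n → Fin 2
    color u = if does (u ∈? A) then zero else suc zero

    proper : Proper G color
    -- Vertices on opposite sides need no clause: `eq` then equates `zero` and `suc zero`.
    proper u w a eq with u ∈? A | w ∈? A | sides u w a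
    ... | yes _  | yes w∈ | inj₁ (_ , w∉)  = w∉ w∈
    ... | yes u∈ | yes _  | inj₂ (u∉ , _)  = u∉ u∈
    ... | no u∉  | no _   | inj₁ (u∈ , _)  = u∉ u∈
    ... | no _   | no w∉  | inj₂ (_ , w∈)  = w∉ w∈

  agree-along-path : ∀ {k} → k ≤ 2 → {c d : Fin n → Fin k} → Proper G c → Proper G d →
    ∀ {u w} → Star Adj u w → d u ≡ c u → d w ≡ c w
  agree-along-path k≤2 pc pd ε       eq = eq
  agree-along-path k≤2 {c} {d} pc pd {u} (_◅_ {j = x} a as) eq =
    agree-along-path k≤2 pc pd as
      -- Both `d x` and `c x` differ from the common color of `u`, and at most one other color is
      -- left.
      (≢-≢⇒≡ k≤2 (pd u x a) (subst (_≢ c x) (sym eq) (pc u x a)))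

  2-colorable⇒sudokuSize-1 : Connected G → Fin n → Colorable G 2 → SudokuSize G 1
  2-colorable⇒sudokuSize-1 conn v col =
    -- A Sudoku coloring takes its colors in `Fin (χ G)`, so `c` is the optimal coloring from
    -- `chromatic`; `col` enters through the bound `χ G ≤ 2`.
    let (c , p) , χ-min = proj₂ (chromatic G) in
    ⁅ v ⁆ , ∣⁅x⁆∣≡1 v , determined⇒sudoku (p , λ d (pd , agree) u →
      agree-along-path (χ-min 2 col) p pd (conn v u) (agree v (x∈⁅x⁆ v)))

theorem3p1 : ∀ (n : ℕ) → 2 ≤ n → (G : FinGraph n) → Connected G → (sn G ≡ 1) ⇔ Bipartite G
theorem3p1 n 2≤n G conn = mk⇔ to from
  where
  sn-size : SudokuSize G (sn G)
  sn-size = proj₁ (proj₂ (sudoku G))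

  to : sn G ≡ 1 → Bipartite G
  to sn≡1 = sudokuSize-1⇒bipartite G (subst (SudokuSize G) sn≡1 sn-size)

  -- let rather than with: abstraction would normalise sn G, an exhaustive search.
  from : Bipartite G → sn G ≡ 1
  from bip = let u , w , a = edge G conn 2≤n in ≤-antisym
    (proj₂ (proj₂ (sudoku G)) 1
      (2-colorable⇒sudokuSize-1 G conn u (bipartite⇒2-colorable G bip)))
    (n≢0⇒n>0 λ sn≡0 → ¬sudokuSize-0 G a (subst (SudokuSize G) sn≡0 sn-size))
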